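{- If $n$ is a non-negative integer and $p$ is a non-zero integer, then $$\sum_{k=0}^n(-1)^{p(n-k)}\frac{n}{n+k}\binom{n+k}{n-k}\left(\frac{F_{3p}}{F_{2p}}\right)^{2k}=\frac{L_p^{4n}+1}{2L_p^{2n}},$$ $$\sum_{k=0}^n(-1)^{(p+1)(n-k)}\frac{n}{n+k}\binom{n+k}{n-k}5^{n-k}\left(\frac{L_{3p}}{F_{2p}}\right)^{2k}=\frac{5^{2n}F_p^{4n}+1}{2F_p^{2n}}.$$
   Context: $F_n$ and $L_n$ ($n\in\mathbb{Z}$) are the Fibonacci and Lucas numbers: $F_0=0$, $F_1=1$, $F_n=F_{n-1}+F_{n-2}$; $L_0=2$, $L_1=1$, $L_n=L_{n-1}+L_{n-2}$, extended to negative indices by $F_{ -n}=(-1)^{n-1}F_n$, $L_{ -n}=(-1)^nL_n$. The coefficient $\frac{n}{n+k}\binom{n+k}{n-k}$ equals $\binom{n+k-1}{k}\binom{n}{k}/\binom{2k}{k}$; for $n=k=0$ it is understood to be $1$. -}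

module Defs where

open import Data.Fin.Base using (toℕ)
open import Data.Integer.Base as ℤ using (ℤ; +_; -[1+_])
import Data.Integer.Properties as ℤ
open import Data.Nat.Base as ℕ using (ℕ; zero; suc; _∸_)
open import Data.Nat.Combinatorics using (_C_)
import Data.Nat.Properties as ℕ
open import Data.Rational.Base as ℚ using (ℚ; 1ℚ; _*_; _/_; _÷_; 1/_)
open import Data.Rational.Literals using (fromℤ)
open import Function.Base using (_∘_; it)

open import Algebra.Definitions.RawSemiring ℚ.+-*-rawSemiring public
  using (_^_; sum)

fib : ℕ → ℕ
fib 0             = 0
fib 1             = 1
fib (suc (suc n)) = fib (suc n) ℕ.+ fib n

luc : ℕ → ℕ
luc 0             = 2
luc 1             = 1
luc (suc (suc n)) = luc (suc n) ℕ.+ luc n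

-- -[1+ m ] is -n for n = m + 1, so the sign (-1)ⁿ⁻¹ of F₋ₙ is (-1)ᵐ and the
-- sign (-1)ⁿ of L₋ₙ is (-1)ᵐ⁺¹.

F : ℤ → ℤ
F (+ n)    = + fib n
F -[1+ m ] = ℤ.-1ℤ ℤ.^ m ℤ.* + fib (suc m)

L : ℤ → ℤ
L (+ n)    = + luc n
L -[1+ m ] = ℤ.-1ℤ ℤ.^ suc m ℤ.* + luc (suc m)

fib-suc-nonZero : ∀ m → ℕ.NonZero (fib (suc m))
fib-suc-nonZero zero    = _
fib-suc-nonZero (suc m) =
  ℕ.>-nonZero (ℕ.≤-trans (ℕ.>-nonZero⁻¹ _ {{fib-suc-nonZero m}}) (ℕ.m≤m+n _ _))

luc-nonZero : ∀ n → ℕ.NonZero (luc n)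
luc-nonZero 0             = _
luc-nonZero 1             = _
luc-nonZero (suc (suc n)) =
  ℕ.>-nonZero (ℕ.≤-trans (ℕ.>-nonZero⁻¹ _ {{luc-nonZero (suc n)}}) (ℕ.m≤m+n _ _))

^-nonZero : ∀ i n .{{_ : ℤ.NonZero i}} → ℤ.NonZero (i ℤ.^ n)
^-nonZero i zero    = _
^-nonZero i (suc n) = ℤ.i*j≢0 i (i ℤ.^ n) {{it}} {{^-nonZero i n}}

F-nonZero : ∀ i .{{_ : ℤ.NonZero i}} → ℤ.NonZero (F i)
F-nonZero (+ suc n) = fib-suc-nonZero n
F-nonZero -[1+ m ]  =
  ℤ.i*j≢0 (ℤ.-1ℤ ℤ.^ m) (+ fib (suc m)) {{^-nonZero ℤ.-1ℤ m}} {{fib-suc-nonZero m}}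

L-nonZero : ∀ i → ℤ.NonZero (L i)
L-nonZero (+ n)    = luc-nonZero n
L-nonZero -[1+ m ] =
  ℤ.i*j≢0 (ℤ.-1ℤ ℤ.^ suc m) (+ luc (suc m)) {{^-nonZero ℤ.-1ℤ (suc m)}} {{luc-nonZero (suc m)}}

F[2p]-nonZero : ∀ p .{{_ : ℤ.NonZero p}} → ℤ.NonZero (F (+ 2 ℤ.* p))
F[2p]-nonZero p = F-nonZero (+ 2 ℤ.* p) {{ℤ.i*j≢0 (+ 2) p}}

2L^-nonZero : ∀ p m → ℤ.NonZero (+ 2 ℤ.* L p ℤ.^ m)
2L^-nonZero p m =
  ℤ.i*j≢0 (+ 2) (L p ℤ.^ m) {{_}} {{^-nonZero (L p) m {{L-nonZero p}}}}

2F^-nonZero : ∀ p m .{{_ : ℤ.NonZero p}} → ℤ.NonZero (+ 2 ℤ.* F p ℤ.^ m)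
2F^-nonZero p m =
  ℤ.i*j≢0 (+ 2) (F p ℤ.^ m) {{_}} {{^-nonZero (F p) m {{F-nonZero p}}}}

infixl 7 _÷ᶻ_
_÷ᶻ_ : (i j : ℤ) .{{_ : ℤ.NonZero j}} → ℚ
i ÷ᶻ j = fromℤ i ÷ fromℤ j

infixr 8 _^ᶻ_
_^ᶻ_ : (x : ℚ) .{{_ : ℚ.NonZero x}} → ℤ → ℚ
x ^ᶻ (+ n)    = x ^ n
x ^ᶻ -[1+ m ] = (1/ x) ^ suc m

-1ℚ : ℚ
-1ℚ = ℚ.- 1ℚ

-- n/(n+k) · binom(n+k, n-k).  At n = k = 0 this reads 0/0 and is taken to be 1.
-- Truncated subtraction agrees with n - k in the summation range k ≤ n.
coeff : ℕ → ℕ → ℚ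
coeff zero      zero      = 1ℚ
coeff n@zero    k@(suc _) = (+ n / (n ℕ.+ k)) * fromℤ (+ ((n ℕ.+ k) C (n ∸ k)))
coeff n@(suc _) k         = (+ n / (n ℕ.+ k)) * fromℤ (+ ((n ℕ.+ k) C (n ∸ k)))

∑≤ : ℕ → (ℕ → ℚ) → ℚ
∑≤ n f = sum {suc n} (f ∘ toℕ)

infix 5 ∑≤
syntax ∑≤ n (λ k → x) = ∑[ k ≤ n ] x

{-# OPTIONS --safe #-}

-- Since 2 n/(n+k) binom(n+k,n-k) = binom(n+k,2k) + binom(n+k-1,2k), Pascal's rule
-- gives the homogeneous sums S_n(q,y) = Σ n/(n+k) binom(n+k,n-k) qⁿ⁻ᵏ yᵏ the
-- recurrence S_{n+2} = (y+2q) S_{n+1} - q² S_n, so 2 S_n(q,y) = aⁿ + bⁿ whenever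
-- a + b = y + 2q and ab = q².  For y = (cu + s/u)² with s² = 1 and q = -cs these
-- roots are a = (cu)² and b = 1/u².  With e = (-1)ᵖ, the identities
-- F_{2p} = F_p L_p, F_{3p} = F_p (L_p² - e) and L_{3p} = L_p (5 F_p² + e) give
-- F_{3p}/F_{2p} = L_p - e/L_p and L_{3p}/F_{2p} = 5 F_p + e/F_p, which are the
-- cases c = 1, s = -e, u = L_p and c = 5, s = e, u = F_p.

module Submission where

open import Defs
open import Algebra.Bundles using (CommutativeRing)
open import Data.Fin.Base using (toℕ)
open import Data.Fin.Properties using (toℕ-fromℕ; toℕ-inject₁; toℕ≤pred[n])
open import Data.Integer.Base as ℤ using (ℤ; +_; -[1+_])
import Data.Integer.Properties as ℤ
import Data.Integer.Tactic.RingSolver as ℤ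
open import Data.Nat.Base as ℕ using (ℕ; zero; suc; _∸_)
open import Data.Nat.Combinatorics
  using (_C_; nC1≡n; nCk≡nC[n∸k]; k>n⇒nCk≡0; nCk+nC[k+1]≡[n+1]C[k+1])
import Data.Nat.Properties as ℕ
import Data.Nat.Tactic.RingSolver as ℕ
open import Data.Product.Base using (_×_; _,_)
open import Data.Rational.Base as ℚ using (ℚ; 0ℚ; 1ℚ; _+_; _*_; _-_; -_; _/_; 1/_)
import Data.Rational.Unnormalised.Base as ℚᵘ
import Data.Rational.Unnormalised.Properties as ℚᵘ
open import Data.Rational.Literals using (fromℤ)
import Data.Rational.Properties as ℚ
import Data.Sign.Base as Sign
open import Function.Base using (_∘_)
open import Level using (0ℓ)
open import Relation.Binary.PropositionalEquality
  using (_≡_; refl; sym; trans; cong; cong₂; module ≡-Reasoning)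
open import Relation.Nullary.Decidable using (dec⇒maybe)
open import Tactic.RingSolver using (solve-∀)
open import Tactic.RingSolver.Core.AlmostCommutativeRing
  using (AlmostCommutativeRing; fromCommutativeRing)

open CommutativeRing ℚ.+-*-commutativeRing using (semiring; commutativeSemiring)
open import Algebra.Properties.Semiring.Sum semiring
  using (sum-cong-≗; sum-init-last; ∑-distrib-+; *-distribˡ-sum)
open import Algebra.Properties.Semiring.Exp semiring using (^-homo-*; ^-assocʳ; ^-congˡ)
open import Algebra.Properties.CommutativeSemiring.Exp commutativeSemiring using (^-distrib-*)

open ≡-Reasoning

-- Rational arithmetic and the embedding of the integers.

ℚ-ring : AlmostCommutativeRing 0ℓ 0ℓ
ℚ-ring = fromCommutativeRing ℚ.+-*-commutativeRing (dec⇒maybe ∘ (0ℚ ℚ.≟_))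

1^n≡1 : ∀ n → 1ℚ ^ n ≡ 1ℚ
1^n≡1 zero    = refl
1^n≡1 (suc n) = trans (ℚ.*-identityˡ _) (1^n≡1 n)

fromℤ-homo-+ : ∀ i j → fromℤ (i ℤ.+ j) ≡ fromℤ i + fromℤ j
fromℤ-homo-+ i j = ℚ.toℚᵘ-injective (ℚᵘ.≃-trans (ℚᵘ.*≡* (cross i j))
  (ℚᵘ.≃-sym (ℚ.toℚᵘ-homo-+ (fromℤ i) (fromℤ j))))
  where
  cross : ∀ i j → (i ℤ.+ j) ℤ.* + 1 ≡ (i ℤ.* + 1 ℤ.+ j ℤ.* + 1) ℤ.* + 1
  cross = ℤ.solve-∀

fromℤ-homo-* : ∀ i j → fromℤ (i ℤ.* j) ≡ fromℤ i * fromℤ j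
fromℤ-homo-* i j = ℚ.toℚᵘ-injective (ℚᵘ.≃-sym (ℚ.toℚᵘ-homo-* (fromℤ i) (fromℤ j)))

fromℕ-homo-* : ∀ m n → fromℤ (+ (m ℕ.* n)) ≡ fromℤ (+ m) * fromℤ (+ n)
fromℕ-homo-* m n = trans (cong fromℤ (ℤ.pos-* m n)) (fromℤ-homo-* (+ m) (+ n))

fromℤ-homo-neg : ∀ i → fromℤ (ℤ.- i) ≡ - fromℤ i
fromℤ-homo-neg i = ℚ.toℚᵘ-injective (ℚᵘ.≃-sym (ℚ.toℚᵘ-homo‿- (fromℤ i)))

fromℤ-homo-^ : ∀ i n → fromℤ (i ℤ.^ n) ≡ fromℤ i ^ n
fromℤ-homo-^ i zero    = refl
fromℤ-homo-^ i (suc n) =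
  trans (fromℤ-homo-* i (i ℤ.^ n)) (cong (fromℤ i *_) (fromℤ-homo-^ i n))

-- Trades a division for a multiplication. The quotients inside the sums and the right-hand sides of
-- the theorem are evaluated through it.
÷ᶻ-unique : ∀ i j r .{{_ : ℤ.NonZero j}} → fromℤ i ≡ r * fromℤ j → i ÷ᶻ j ≡ r
÷ᶻ-unique i j r eq = begin
  fromℤ i * 1/ fromℤ j          ≡⟨ cong (_* 1/ fromℤ j) eq ⟩
  (r * fromℤ j) * 1/ fromℤ j    ≡⟨ ℚ.*-assoc r _ _ ⟩
  r * (fromℤ j * 1/ fromℤ j)    ≡⟨ cong (r *_) (ℚ.*-inverseʳ (fromℤ j)) ⟩
  r * 1ℚ                        ≡⟨ ℚ.*-identityʳ r ⟩
  r                             ∎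

-- `_/_` reduces to lowest terms, so the comparison is made among unnormalised rationals, where a
-- cross-multiplication suffices. It puts `coeff` in a form whose denominator can be cancelled.
/≡÷ᶻ : ∀ i d .{{_ : ℕ.NonZero d}} → i / d ≡ i ÷ᶻ + d
/≡÷ᶻ i d@(suc d-1) = sym (÷ᶻ-unique i (+ d) (i / d) (ℚ.toℚᵘ-injective
  (ℚᵘ.≃-trans (ℚᵘ.*≡* cross)
  (ℚᵘ.≃-trans (ℚᵘ.*-congʳ (ℚᵘ.≃-sym (ℚ.toℚᵘ-fromℚᵘ (ℚᵘ.mkℚᵘ i d-1))))
              (ℚᵘ.≃-sym (ℚ.toℚᵘ-homo-* (i / d) (fromℤ (+ d))))))))
  where
  cross : i ℤ.* + (d ℕ.* 1) ≡ (i ℤ.* + d) ℤ.* + 1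
  cross = trans (cong (λ z → i ℤ.* + z) (ℕ.*-identityʳ d)) (sym (ℤ.*-identityʳ _))

-- Binomial coefficients

[1+k]*[1+n]C[1+k]≡[1+n]*nCk : ∀ n k → suc k ℕ.* (suc n C suc k) ≡ suc n ℕ.* (n C k)
[1+k]*[1+n]C[1+k]≡[1+n]*nCk zero    zero    = refl
[1+k]*[1+n]C[1+k]≡[1+n]*nCk zero    (suc k) = ℕ.*-zeroʳ k
[1+k]*[1+n]C[1+k]≡[1+n]*nCk (suc n) zero    =
  trans (ℕ.*-identityˡ _) (trans (nC1≡n (suc (suc n))) (sym (ℕ.*-identityʳ _)))
[1+k]*[1+n]C[1+k]≡[1+n]*nCk (suc n) (suc k) = begin
  suc (suc k) ℕ.* (suc (suc n) C suc (suc k))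
    ≡⟨ cong (suc (suc k) ℕ.*_) (nCk+nC[k+1]≡[n+1]C[k+1] (suc n) (suc k)) ⟨
  suc (suc k) ℕ.* (x ℕ.+ (suc n C suc (suc k)))
    ≡⟨ ℕ.*-distribˡ-+ (suc (suc k)) x _ ⟩
  (x ℕ.+ suc k ℕ.* x) ℕ.+ suc (suc k) ℕ.* (suc n C suc (suc k))
    ≡⟨ cong₂ (λ a b → (x ℕ.+ a) ℕ.+ b)
         ([1+k]*[1+n]C[1+k]≡[1+n]*nCk n k) ([1+k]*[1+n]C[1+k]≡[1+n]*nCk n (suc k)) ⟩
  (x ℕ.+ suc n ℕ.* (n C k)) ℕ.+ suc n ℕ.* (n C suc k)
    ≡⟨ ℕ.+-assoc x _ _ ⟩
  x ℕ.+ (suc n ℕ.* (n C k) ℕ.+ suc n ℕ.* (n C suc k))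
    ≡⟨ cong (x ℕ.+_) (ℕ.*-distribˡ-+ (suc n) (n C k) (n C suc k)) ⟨
  x ℕ.+ suc n ℕ.* (n C k ℕ.+ n C suc k)
    ≡⟨ cong (λ z → x ℕ.+ suc n ℕ.* z) (nCk+nC[k+1]≡[n+1]C[k+1] n k) ⟩
  suc (suc n) ℕ.* x ∎
  where
  x = suc n C suc k

-- Absorption combined with Pascal's rule. The term with factor k stands on the left so that no
-- truncated subtraction n + 1 - k occurs.
[1+n]*nCk+k*[1+n]Ck≡[1+n]*[1+n]Ck : ∀ n k →
  suc n ℕ.* (n C k) ℕ.+ k ℕ.* (suc n C k) ≡ suc n ℕ.* (suc n C k)
[1+n]*nCk+k*[1+n]Ck≡[1+n]*[1+n]Ck n zero    = ℕ.+-identityʳ _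
[1+n]*nCk+k*[1+n]Ck≡[1+n]*[1+n]Ck n (suc k) = begin
  suc n ℕ.* (n C suc k) ℕ.+ suc k ℕ.* (suc n C suc k)
    ≡⟨ cong (suc n ℕ.* (n C suc k) ℕ.+_) ([1+k]*[1+n]C[1+k]≡[1+n]*nCk n k) ⟩
  suc n ℕ.* (n C suc k) ℕ.+ suc n ℕ.* (n C k)
    ≡⟨ ℕ.*-distribˡ-+ (suc n) (n C suc k) (n C k) ⟨
  suc n ℕ.* (n C suc k ℕ.+ n C k)
    ≡⟨ cong (suc n ℕ.*_) (trans (ℕ.+-comm (n C suc k) _) (nCk+nC[k+1]≡[n+1]C[k+1] n k)) ⟩
  suc n ℕ.* (suc n C suc k) ∎

-- By the preceding rule (N + 1) C(N, 2k) = (N + 1 - 2k) C(N + 1, 2k), so the total factor of C(N +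
-- 1, 2k) is 2(N + 1) - 2k = 2(n + 1). The proof adds `j * A` to both sides and cancels it, to avoid
-- subtraction.
[1+n+k]*[C+C]≡2[1+n]*C : ∀ n k → let N = n ℕ.+ k; j = 2 ℕ.* k in
  suc N ℕ.* ((suc N C j) ℕ.+ (N C j)) ≡ (suc n ℕ.+ suc n) ℕ.* (suc N C j)
[1+n+k]*[C+C]≡2[1+n]*C n k = ℕ.+-cancelʳ-≡ (j ℕ.* A) _ _ (begin
  suc N ℕ.* (A ℕ.+ B) ℕ.+ j ℕ.* A           ≡⟨ regroup N k A B ⟩
  suc N ℕ.* A ℕ.+ (suc N ℕ.* B ℕ.+ j ℕ.* A)
    ≡⟨ cong (suc N ℕ.* A ℕ.+_) ([1+n]*nCk+k*[1+n]Ck≡[1+n]*[1+n]Ck N j) ⟩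
  suc N ℕ.* A ℕ.+ suc N ℕ.* A               ≡⟨ regroup′ n k A ⟩
  (suc n ℕ.+ suc n) ℕ.* A ℕ.+ j ℕ.* A       ∎)
  where
  N = n ℕ.+ k
  j = 2 ℕ.* k
  A = suc N C j
  B = N C j
  regroup : ∀ N k A B → suc N ℕ.* (A ℕ.+ B) ℕ.+ 2 ℕ.* k ℕ.* A
                      ≡ suc N ℕ.* A ℕ.+ (suc N ℕ.* B ℕ.+ 2 ℕ.* k ℕ.* A)
  regroup = ℕ.solve-∀
  regroup′ : ∀ n k A → suc (n ℕ.+ k) ℕ.* A ℕ.+ suc (n ℕ.+ k) ℕ.* A
                     ≡ (suc n ℕ.+ suc n) ℕ.* A ℕ.+ 2 ℕ.* k ℕ.* A
  regroup′ = ℕ.solve-∀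

C-sym : ∀ n k → k ℕ.≤ n → (n ℕ.+ k) C (n ∸ k) ≡ (n ℕ.+ k) C (2 ℕ.* k)
C-sym n k k≤n = begin
  (n ℕ.+ k) C (n ∸ k)
    ≡⟨ nCk≡nC[n∸k] (ℕ.≤-trans (ℕ.m∸n≤m n k) (ℕ.m≤m+n n k)) ⟩
  (n ℕ.+ k) C (n ℕ.+ k ∸ (n ∸ k))
    ≡⟨ cong ((n ℕ.+ k) C_) (begin
         n ℕ.+ k ∸ (n ∸ k)                ≡⟨ cong (_∸ (n ∸ k)) eq ⟩
         2 ℕ.* k ℕ.+ (n ∸ k) ∸ (n ∸ k)    ≡⟨ ℕ.m+n∸n≡m (2 ℕ.* k) (n ∸ k) ⟩
         2 ℕ.* k                          ∎) ⟩
  (n ℕ.+ k) C (2 ℕ.* k) ∎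
  where
  regroup : ∀ d k → d ℕ.+ k ℕ.+ k ≡ 2 ℕ.* k ℕ.+ d
  regroup = ℕ.solve-∀
  eq : n ℕ.+ k ≡ 2 ℕ.* k ℕ.+ (n ∸ k)
  eq = trans (cong (ℕ._+ k) (sym (ℕ.m∸n+n≡m k≤n))) (regroup (n ∸ k) k)

binom : ℕ → ℕ → ℚ
binom n k = fromℤ (+ (n C k))

-- The coefficient is half a sum of two binomials, and doubling avoids the halves. Starting from
-- `suc n` writes n + k - 1 without subtraction and leaves out the case 0/0.
coeff+coeff≡binom+binom : ∀ n k → k ℕ.≤ suc n →
  coeff (suc n) k + coeff (suc n) k
    ≡ binom (suc n ℕ.+ k) (2 ℕ.* k) + binom (n ℕ.+ k) (2 ℕ.* k)
coeff+coeff≡binom+binom n k k≤1+n = begin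
  coeff (suc n) k + coeff (suc n) k
    ≡⟨ cong (λ z → z + z) (cong₂ _*_ (/≡÷ᶻ (+ suc n) (suc N)) (cong (λ z → fromℤ (+ z)) (C-sym (suc n) k k≤1+n))) ⟩
  m ÷ᶻ (+ suc N) * a + m ÷ᶻ (+ suc N) * a
    ≡⟨ regroup (fromℤ m) (1/ s) a ⟩
  (fromℤ m + fromℤ m) * a * 1/ s
    ≡⟨ cong (_* 1/ s) key ⟩
  (a + b) * s * 1/ s
    ≡⟨ ℚ.*-assoc (a + b) s (1/ s) ⟩
  (a + b) * (s * 1/ s)
    ≡⟨ cong ((a + b) *_) (ℚ.*-inverseʳ s) ⟩
  (a + b) * 1ℚ
    ≡⟨ ℚ.*-identityʳ (a + b) ⟩
  a + b ∎
  where
  N = n ℕ.+ k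
  j = 2 ℕ.* k
  m = + suc n
  s = fromℤ (+ suc N)
  a = binom (suc N) j
  b = binom N j
  regroup : ∀ m i a → m * i * a + m * i * a ≡ (m + m) * a * i
  regroup = solve-∀ ℚ-ring
  key : (fromℤ m + fromℤ m) * a ≡ (a + b) * s
  key = begin
    (fromℤ m + fromℤ m) * a
      ≡⟨ cong (_* a) (fromℤ-homo-+ m m) ⟨
    fromℤ (m ℤ.+ m) * a
      ≡⟨ fromℕ-homo-* (suc n ℕ.+ suc n) (suc N C j) ⟨
    fromℤ (+ ((suc n ℕ.+ suc n) ℕ.* (suc N C j)))
      ≡⟨ cong (λ z → fromℤ (+ z)) (trans (ℕ.*-comm _ (suc N)) ([1+n+k]*[C+C]≡2[1+n]*C n k)) ⟨
    fromℤ (+ (((suc N C j) ℕ.+ (N C j)) ℕ.* suc N))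
      ≡⟨ fromℕ-homo-* ((suc N C j) ℕ.+ (N C j)) (suc N) ⟩
    fromℤ (+ (suc N C j) ℤ.+ + (N C j)) * s
      ≡⟨ cong (_* s) (fromℤ-homo-+ (+ (suc N C j)) (+ (N C j))) ⟩
    (a + b) * s ∎

-- Homogeneous sums

∑-cong : ∀ n {f g} → (∀ k → k ℕ.≤ n → f k ≡ g k) → ∑≤ n f ≡ ∑≤ n g
∑-cong n f≗g = sum-cong-≗ {suc n} λ i → f≗g (toℕ i) (toℕ≤pred[n] i)

∑-last : ∀ n f → ∑≤ (suc n) f ≡ ∑≤ n f + f (suc n)
∑-last n f = trans (sum-init-last {suc n} (f ∘ toℕ))
  (cong₂ _+_ (sum-cong-≗ {suc n} (cong f ∘ toℕ-inject₁)) (cong (f ∘ suc) (toℕ-fromℕ n)))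

-- On coefficient sequences this is multiplication by the variable `y`.
shift : (ℕ → ℚ) → ℕ → ℚ
shift a zero    = 0ℚ
shift a (suc k) = a k

-- Coefficients of the Morgan-Voyce polynomials b_n and B_n, taken from the even and the odd columns
-- of Pascal's triangle.
evenC oddC : ℕ → ℕ → ℚ
evenC n k = binom (n ℕ.+ k) (2 ℕ.* k)
oddC  n k = binom (suc (n ℕ.+ k)) (suc (2 ℕ.* k))

pascal : ∀ n k →
  binom (suc n) (suc k) ≡ binom n k + binom n (suc k)
pascal n k = trans (cong (λ z → fromℤ (+ z)) (sym (nCk+nC[k+1]≡[n+1]C[k+1] n k)))
  (fromℤ-homo-+ (+ (n C k)) (+ (n C suc k)))

-- Pascal's rule lowers column 2k to 2k - 1 = 2(k - 1) + 1, the odd column that belongs to k - 1;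
-- hence the `shift`.
evenC-suc : ∀ n k → evenC (suc n) k ≡ evenC n k + shift (oddC n) k
evenC-suc n zero    = refl
evenC-suc n (suc k) = begin
  binom (suc (n ℕ.+ suc k)) (2 ℕ.* suc k)
    -- `2 * suc k` unfolds to `suc (k + suc (k + 0))`, which fixes the spelling of the lower index
    -- until `+-suc` rewrites it.
    ≡⟨ pascal (n ℕ.+ suc k) (k ℕ.+ suc (k ℕ.+ 0)) ⟩
  binom (n ℕ.+ suc k) (k ℕ.+ suc (k ℕ.+ 0)) + evenC n (suc k)
    ≡⟨ ℚ.+-comm (binom (n ℕ.+ suc k) (k ℕ.+ suc (k ℕ.+ 0))) (evenC n (suc k)) ⟩
  evenC n (suc k) + binom (n ℕ.+ suc k) (k ℕ.+ suc (k ℕ.+ 0))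
    ≡⟨ cong₂ (λ a b → evenC n (suc k) + binom a b) (ℕ.+-suc n k) (ℕ.+-suc k (k ℕ.+ 0)) ⟩
  evenC n (suc k) + oddC n k ∎

-- Row n ends at k = n; the zero at k = n + 1 lets the same row be summed up to n + 1.
evenC-vanish : ∀ n → evenC n (suc n) ≡ 0ℚ
evenC-vanish n = cong (λ z → fromℤ (+ z)) (k>n⇒nCk≡0
  (ℕ.s≤s (ℕ.≤-reflexive (cong (λ z → n ℕ.+ suc z) (sym (ℕ.+-identityʳ n))))))

oddC-vanish : ∀ n → oddC n (suc n) ≡ 0ℚ
oddC-vanish n = cong (λ z → fromℤ (+ z)) (k>n⇒nCk≡0
  (ℕ.s≤s (ℕ.s≤s (ℕ.≤-reflexive (cong (λ z → n ℕ.+ suc z) (sym (ℕ.+-identityʳ n)))))))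

module _ (q y : ℚ) where

  -- The factors stand in the order of the theorem's summands, so that those can be rewritten factor
  -- by factor.
  homogeneous : ℕ → (ℕ → ℚ) → ℚ
  homogeneous n a = ∑[ k ≤ n ] (q ^ (n ∸ k) * a k * y ^ k)

  homogeneous-cong : ∀ n {a b} → (∀ k → k ℕ.≤ n → a k ≡ b k) →
    homogeneous n a ≡ homogeneous n b
  homogeneous-cong n a≗b =
    ∑-cong n λ k k≤n → cong (λ z → q ^ (n ∸ k) * z * y ^ k) (a≗b k k≤n)

  homogeneous-+ : ∀ n a b →
    homogeneous n (λ k → a k + b k) ≡ homogeneous n a + homogeneous n b
  homogeneous-+ n a b = trans
    (∑-cong n λ k _ → distrib (q ^ (n ∸ k)) (a k) (b k) (y ^ k))
    (∑-distrib-+ {suc n} (term a ∘ toℕ) (term b ∘ toℕ))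
    where
    term : (ℕ → ℚ) → ℕ → ℚ
    term c k = q ^ (n ∸ k) * c k * y ^ k
    distrib : ∀ x a b z → x * (a + b) * z ≡ x * a * z + x * b * z
    distrib = solve-∀ ℚ-ring

  -- Without a top coefficient every term has a spare factor `q`: for k ≤ n the truncated n + 1 - k
  -- is one more than n - k.
  homogeneous-suc : ∀ n a → a (suc n) ≡ 0ℚ →
    homogeneous (suc n) a ≡ q * homogeneous n a
  homogeneous-suc n a a[1+n]≡0 = begin
    homogeneous (suc n) a
      ≡⟨ ∑-last n (λ k → q ^ (suc n ∸ k) * a k * y ^ k) ⟩
    (∑[ k ≤ n ] (q ^ (suc n ∸ k) * a k * y ^ k)) + q ^ (n ∸ n) * a (suc n) * y ^ suc n
      ≡⟨ cong₂ _+_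
           (∑-cong n λ k k≤n → trans
             (cong (λ m → q ^ m * a k * y ^ k) (ℕ.+-∸-assoc 1 k≤n))
             (assoc q (q ^ (n ∸ k)) (a k) (y ^ k)))
           (trans (cong (λ z → q ^ (n ∸ n) * z * y ^ suc n) a[1+n]≡0)
             (vanish (q ^ (n ∸ n)) (y ^ suc n))) ⟩
    (∑[ k ≤ n ] (q * (q ^ (n ∸ k) * a k * y ^ k))) + 0ℚ
      ≡⟨ ℚ.+-identityʳ _ ⟩
    (∑[ k ≤ n ] (q * (q ^ (n ∸ k) * a k * y ^ k)))
      ≡⟨ *-distribˡ-sum {suc n} q (λ i → q ^ (n ∸ toℕ i) * a (toℕ i) * y ^ toℕ i) ⟨
    q * homogeneous n a ∎
    where
    assoc : ∀ q x a z → q * x * a * z ≡ q * (x * a * z)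
    assoc = solve-∀ ℚ-ring
    vanish : ∀ x z → x * 0ℚ * z ≡ 0ℚ
    vanish x z = trans (cong (_* z) (ℚ.*-zeroʳ x)) (ℚ.*-zeroˡ z)

  homogeneous-shift : ∀ n a → homogeneous (suc n) (shift a) ≡ y * homogeneous n a
  homogeneous-shift n a = begin
    q ^ suc n * 0ℚ * 1ℚ + (∑[ k ≤ n ] (q ^ (n ∸ k) * a k * y ^ suc k))
      ≡⟨ cong₂ _+_
           (trans (ℚ.*-identityʳ _) (ℚ.*-zeroʳ (q ^ suc n)))
           (∑-cong n λ k _ → rearrange y (q ^ (n ∸ k)) (a k) (y ^ k)) ⟩
    0ℚ + (∑[ k ≤ n ] (y * (q ^ (n ∸ k) * a k * y ^ k)))
      ≡⟨ ℚ.+-identityˡ _ ⟩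
    (∑[ k ≤ n ] (y * (q ^ (n ∸ k) * a k * y ^ k)))
      ≡⟨ *-distribˡ-sum {suc n} y (λ i → q ^ (n ∸ toℕ i) * a (toℕ i) * y ^ toℕ i) ⟨
    y * homogeneous n a ∎
    where
    rearrange : ∀ y x a z → x * a * (y * z) ≡ y * (x * a * z)
    rearrange = solve-∀ ℚ-ring

  evenPart oddPart : ℕ → ℚ
  evenPart n = homogeneous n (evenC n)
  oddPart  n = homogeneous n (oddC n)

  evenPart-suc : ∀ n → evenPart (suc n) ≡ q * evenPart n + y * oddPart n
  evenPart-suc n = begin
    homogeneous (suc n) (evenC (suc n))
      ≡⟨ homogeneous-cong (suc n) (λ k _ → evenC-suc n k) ⟩
    homogeneous (suc n) (λ k → evenC n k + shift (oddC n) k)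
      ≡⟨ homogeneous-+ (suc n) (evenC n) (shift (oddC n)) ⟩
    homogeneous (suc n) (evenC n) + homogeneous (suc n) (shift (oddC n))
      ≡⟨ cong₂ _+_ (homogeneous-suc n (evenC n) (evenC-vanish n)) (homogeneous-shift n (oddC n)) ⟩
    q * evenPart n + y * oddPart n ∎

  oddPart-suc : ∀ n → oddPart (suc n) ≡ evenPart (suc n) + q * oddPart n
  oddPart-suc n = begin
    homogeneous (suc n) (oddC (suc n))
      ≡⟨ homogeneous-cong (suc n) (λ k _ → pascal (suc n ℕ.+ k) (2 ℕ.* k)) ⟩
    homogeneous (suc n) (λ k → evenC (suc n) k + oddC n k)
      ≡⟨ homogeneous-+ (suc n) (evenC (suc n)) (oddC n) ⟩
    evenPart (suc n) + homogeneous (suc n) (oddC n)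
      ≡⟨ cong (λ z → evenPart (suc n) + z) (homogeneous-suc n (oddC n) (oddC-vanish n)) ⟩
    evenPart (suc n) + q * oddPart n ∎

  -- Eliminates `oddPart` from the two one-step relations, by means of y * oddPart n = evenPart (n +
  -- 1) - q * evenPart n.
  evenPart-rec : ∀ n →
    evenPart (suc (suc n)) ≡ (y + (q + q)) * evenPart (suc n) - (q * q) * evenPart n
  evenPart-rec n = begin
    evenPart (suc (suc n))                    ≡⟨ evenPart-suc (suc n) ⟩
    q * D′ + y * oddPart (suc n)              ≡⟨ cong (λ z → q * D′ + y * z) (oddPart-suc n) ⟩
    q * D′ + y * (D′ + q * E)                 ≡⟨ expand q y D D′ E ⟩
    (y + q) * D′ + q * (q * D + y * E) - (q * q) * D
      ≡⟨ cong (λ z → (y + q) * D′ + q * z - (q * q) * D) (evenPart-suc n) ⟨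
    (y + q) * D′ + q * D′ - (q * q) * D       ≡⟨ collect q y D D′ ⟩
    (y + (q + q)) * D′ - (q * q) * D          ∎
    where
    D = evenPart n
    D′ = evenPart (suc n)
    E = oddPart n
    expand : ∀ q y D D′ E →
      q * D′ + y * (D′ + q * E) ≡ (y + q) * D′ + q * (q * D + y * E) - (q * q) * D
    expand = solve-∀ ℚ-ring
    collect : ∀ q y D D′ →
      (y + q) * D′ + q * D′ - (q * q) * D ≡ (y + (q + q)) * D′ - (q * q) * D
    collect = solve-∀ ℚ-ring

  -- Power sums of the two roots.

  module _ {a b} (a+b≡y+2q : a + b ≡ y + (q + q)) (ab≡q² : a * b ≡ q * q) where

    -- Both sides obey the second-order recurrence with coefficients a + b = y + 2q and ab = q², so
    -- agreement at n = 0 and n = 1 suffices.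
    evenPart-powerSum : ∀ n →
      evenPart (suc n) + q * evenPart n ≡ a ^ suc n + b ^ suc n
    evenPart-powerSum zero = begin
      -- `evenPart 0` and `oddPart 0` compute to 1, and `a ^ 1` unfolds to `a * 1ℚ`; hence the
      -- explicit ones.
      evenPart 1 + q * 1ℚ           ≡⟨ cong (_+ q * 1ℚ) (evenPart-suc 0) ⟩
      q * 1ℚ + y * 1ℚ + q * 1ℚ      ≡⟨ lemma q y ⟩
      (y + (q + q)) * 1ℚ            ≡⟨ cong (_* 1ℚ) a+b≡y+2q ⟨
      (a + b) * 1ℚ                  ≡⟨ ℚ.*-distribʳ-+ 1ℚ a b ⟩
      a * 1ℚ + b * 1ℚ               ∎
      where
      lemma : ∀ q y → q * 1ℚ + y * 1ℚ + q * 1ℚ ≡ (y + (q + q)) * 1ℚ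
      lemma = solve-∀ ℚ-ring
    evenPart-powerSum (suc zero) = begin
      evenPart 2 + q * evenPart 1
        ≡⟨ cong (_+ q * evenPart 1) (evenPart-rec 0) ⟩
      (y + (q + q)) * evenPart 1 - (q * q) * 1ℚ + q * evenPart 1
        ≡⟨ cong (λ z → (y + (q + q)) * z - (q * q) * 1ℚ + q * z) (evenPart-suc 0) ⟩
      (y + (q + q)) * (q * 1ℚ + y * 1ℚ) - (q * q) * 1ℚ + q * (q * 1ℚ + y * 1ℚ)
        ≡⟨ lemma q y ⟩
      (y + (q + q)) * (y + (q + q)) - (q * q + q * q)
        ≡⟨ cong₂ (λ s p → s * s - (p + p)) a+b≡y+2q ab≡q² ⟨
      (a + b) * (a + b) - (a * b + a * b)
        ≡⟨ lemma′ a b ⟩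
      a * (a * 1ℚ) + b * (b * 1ℚ) ∎
      where
      lemma : ∀ q y →
        (y + (q + q)) * (q * 1ℚ + y * 1ℚ) - (q * q) * 1ℚ + q * (q * 1ℚ + y * 1ℚ)
          ≡ (y + (q + q)) * (y + (q + q)) - (q * q + q * q)
      lemma = solve-∀ ℚ-ring
      lemma′ : ∀ a b →
        (a + b) * (a + b) - (a * b + a * b) ≡ a * (a * 1ℚ) + b * (b * 1ℚ)
      lemma′ = solve-∀ ℚ-ring
    evenPart-powerSum (suc (suc n)) = begin
      evenPart (3 ℕ.+ n) + q * evenPart (2 ℕ.+ n)
        ≡⟨ cong₂ (λ u v → u + q * v) (evenPart-rec (suc n)) (evenPart-rec n) ⟩
      (s * D₂ - p * D₁) + q * (s * D₁ - p * D₀)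
        ≡⟨ collect q s p D₀ D₁ D₂ ⟩
      s * (D₂ + q * D₁) - p * (D₁ + q * D₀)
        ≡⟨ cong₂ (λ u v → s * u - p * v) (evenPart-powerSum (suc n)) (evenPart-powerSum n) ⟩
      s * (a ^ (2 ℕ.+ n) + b ^ (2 ℕ.+ n)) - p * (a ^ suc n + b ^ suc n)
        ≡⟨ cong₂ (λ s p → s * (a ^ (2 ℕ.+ n) + b ^ (2 ℕ.+ n)) - p * (a ^ suc n + b ^ suc n))
             a+b≡y+2q ab≡q² ⟨
      (a + b) * (a ^ (2 ℕ.+ n) + b ^ (2 ℕ.+ n)) - (a * b) * (a ^ suc n + b ^ suc n)
        ≡⟨ newton a b (a ^ suc n) (b ^ suc n) ⟩
      a ^ (3 ℕ.+ n) + b ^ (3 ℕ.+ n) ∎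
      where
      s = y + (q + q)
      p = q * q
      D₀ = evenPart n
      D₁ = evenPart (suc n)
      D₂ = evenPart (suc (suc n))
      collect : ∀ q s p D₀ D₁ D₂ → (s * D₂ - p * D₁) + q * (s * D₁ - p * D₀)
        ≡ s * (D₂ + q * D₁) - p * (D₁ + q * D₀)
      collect = solve-∀ ℚ-ring
      newton : ∀ a b x z → (a + b) * (a * x + b * z) - (a * b) * (x + z)
        ≡ a * (a * x) + b * (b * z)
      newton = solve-∀ ℚ-ring

    coeff-powerSum : ∀ n →
      homogeneous n (coeff n) + homogeneous n (coeff n) ≡ a ^ n + b ^ n
    -- The convention that the 0/0 coefficient is 1 enters here: both sides compute to 1 + 1.
    coeff-powerSum zero    = refl
    coeff-powerSum (suc n) = begin
      homogeneous (suc n) (coeff (suc n)) + homogeneous (suc n) (coeff (suc n))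
        ≡⟨ homogeneous-+ (suc n) (coeff (suc n)) (coeff (suc n)) ⟨
      homogeneous (suc n) (λ k → coeff (suc n) k + coeff (suc n) k)
        ≡⟨ homogeneous-cong (suc n) (coeff+coeff≡binom+binom n) ⟩
      homogeneous (suc n) (λ k → evenC (suc n) k + evenC n k)
        ≡⟨ homogeneous-+ (suc n) (evenC (suc n)) (evenC n) ⟩
      evenPart (suc n) + homogeneous (suc n) (evenC n)
        ≡⟨ cong (λ z → evenPart (suc n) + z) (homogeneous-suc n (evenC n) (evenC-vanish n)) ⟩
      evenPart (suc n) + q * evenPart n
        ≡⟨ evenPart-powerSum n ⟩
      a ^ suc n + b ^ suc n ∎

-- Serves both identities of the theorem. `v` is 1/u as a separate variable, so that the ring solver
-- sees only polynomials. The factor 2u^(2n) clears the denominator and turns the power v^(2n) of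
-- the second root into (uv)^(2n) = 1.
coeff-powerSum-scaled : ∀ c s u v → s * s ≡ 1ℚ → u * v ≡ 1ℚ → ∀ n →
  homogeneous (- (c * s)) ((c * u + s * v) ^ 2) n (coeff n) * (fromℤ (+ 2) * u ^ (2 ℕ.* n))
    ≡ c ^ (2 ℕ.* n) * u ^ (4 ℕ.* n) + 1ℚ
coeff-powerSum-scaled c s u v s²≡1 uv≡1 n = begin
  H * (fromℤ (+ 2) * U)           ≡⟨ double H U ⟩
  (H + H) * U                     ≡⟨ cong (_* U) (coeff-powerSum q (x ^ 2) sum-roots product-roots n) ⟩
  (((c * u) ^ 2) ^ n + (v ^ 2) ^ n) * U
    ≡⟨ cong₂ (λ a b → (a + b) * U)
         (trans (^-assocʳ (c * u) 2 n) (^-distrib-* c u (2 ℕ.* n))) (^-assocʳ v 2 n) ⟩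
  (c ^ (2 ℕ.* n) * U + v ^ (2 ℕ.* n)) * U
    ≡⟨ expand (c ^ (2 ℕ.* n)) U (v ^ (2 ℕ.* n)) ⟩
  c ^ (2 ℕ.* n) * (U * U) + U * v ^ (2 ℕ.* n)
    ≡⟨ cong₂ (λ a b → c ^ (2 ℕ.* n) * a + b)
         (trans (sym (^-homo-* u (2 ℕ.* n) (2 ℕ.* n))) (cong (u ^_) (2n+2n≡4n n)))
         (trans (sym (^-distrib-* u v (2 ℕ.* n)))
           (trans (^-congˡ (2 ℕ.* n) uv≡1) (1^n≡1 (2 ℕ.* n)))) ⟩
  c ^ (2 ℕ.* n) * u ^ (4 ℕ.* n) + 1ℚ ∎
  where
  q = - (c * s)
  x = c * u + s * v
  H = homogeneous q (x ^ 2) n (coeff n)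
  U = u ^ (2 ℕ.* n)

  double : ∀ h z → h * (fromℤ (+ 2) * z) ≡ (h + h) * z
  double = solve-∀ ℚ-ring
  expand : ∀ c u v → (c * u + v) * u ≡ c * (u * u) + u * v
  expand = solve-∀ ℚ-ring
  2n+2n≡4n : ∀ n → 2 ℕ.* n ℕ.+ 2 ℕ.* n ≡ 4 ℕ.* n
  2n+2n≡4n = ℕ.solve-∀

  sum-roots : (c * u) ^ 2 + v ^ 2 ≡ x ^ 2 + (q + q)
  sum-roots = begin
    (c * u) ^ 2 + v ^ 2
      -- Expanding x² + 2q yields s²v² and the cross terms 2cs(uv - 1). The inserted ones mark the
      -- places where s² and uv are substituted.
      ≡⟨ insert c s u v ⟩
    (c * u) * (c * u) + 1ℚ * (v * v) + (c * s) * (1ℚ - 1ℚ) + (c * s) * (1ℚ - 1ℚ)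
      ≡⟨ cong₂ (λ a b → (c * u) * (c * u) + a * (v * v) + (c * s) * (b - 1ℚ) + (c * s) * (b - 1ℚ))
           s²≡1 uv≡1 ⟨
    (c * u) * (c * u) + (s * s) * (v * v) + (c * s) * (u * v - 1ℚ) + (c * s) * (u * v - 1ℚ)
      ≡⟨ square c s u v ⟩
    x ^ 2 + (q + q) ∎
    where
    insert : ∀ c s u v → (c * u) * ((c * u) * 1ℚ) + v * (v * 1ℚ)
      ≡ (c * u) * (c * u) + 1ℚ * (v * v) + (c * s) * (1ℚ - 1ℚ) + (c * s) * (1ℚ - 1ℚ)
    insert = solve-∀ ℚ-ring
    square : ∀ c s u v →
      (c * u) * (c * u) + (s * s) * (v * v) + (c * s) * (u * v - 1ℚ) + (c * s) * (u * v - 1ℚ)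
        ≡ (c * u + s * v) * ((c * u + s * v) * 1ℚ) + (- (c * s) + - (c * s))
    square = solve-∀ ℚ-ring

  product-roots : (c * u) ^ 2 * v ^ 2 ≡ q * q
  product-roots = begin
    (c * u) ^ 2 * v ^ 2            ≡⟨ regroup c u v ⟩
    (c * c) * ((u * v) * (u * v))  ≡⟨ cong (λ z → (c * c) * (z * z)) uv≡1 ⟩
    (c * c) * (1ℚ * 1ℚ)            ≡⟨ cong ((c * c) *_) s²≡1 ⟨
    (c * c) * (s * s)              ≡⟨ signs c s ⟩
    q * q                          ∎
    where
    regroup : ∀ c u v → (c * u) * ((c * u) * 1ℚ) * (v * (v * 1ℚ)) ≡ (c * c) * ((u * v) * (u * v))
    regroup = solve-∀ ℚ-ring
    signs : ∀ c s → (c * c) * (s * s) ≡ - (c * s) * - (c * s)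
    signs = solve-∀ ℚ-ring

-- Fibonacci and Lucas numbers

-- The addition formula F_m F_(n+1) + F_(m-1) F_n with F_(m-1) written as F_(m+1) - F_m, so that
-- indices stay natural. Both sides satisfy the Fibonacci recurrence in m.
fib-+ : ∀ m n → + fib (m ℕ.+ n) ≡
  + fib m ℤ.* + fib (suc n) ℤ.+ + fib (suc m) ℤ.* + fib n ℤ.- + fib m ℤ.* + fib n
fib-+ zero          n = lemma (+ fib n) (+ fib (suc n))
  where
  lemma : ∀ a b → a ≡ ℤ.0ℤ ℤ.* b ℤ.+ ℤ.1ℤ ℤ.* a ℤ.- ℤ.0ℤ ℤ.* a
  lemma = ℤ.solve-∀
fib-+ (suc zero)    n = lemma (+ fib n) (+ fib (suc n))
  where
  lemma : ∀ a b → b ≡ ℤ.1ℤ ℤ.* b ℤ.+ ℤ.1ℤ ℤ.* a ℤ.- ℤ.1ℤ ℤ.* a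
  lemma = ℤ.solve-∀
fib-+ (suc (suc m)) n =
  trans (cong₂ ℤ._+_ (fib-+ (suc m) n) (fib-+ m n))
    (lemma (+ fib n) (+ fib (suc n)) (+ fib m) (+ fib (suc m)))
  where
  lemma : ∀ a b c d →
    (d ℤ.* b ℤ.+ (d ℤ.+ c) ℤ.* a ℤ.- d ℤ.* a) ℤ.+ (c ℤ.* b ℤ.+ d ℤ.* a ℤ.- c ℤ.* a)
      ≡ (d ℤ.+ c) ℤ.* b ℤ.+ (d ℤ.+ c ℤ.+ d) ℤ.* a ℤ.- (d ℤ.+ c) ℤ.* a
  lemma = ℤ.solve-∀

-- Cassini's F_(n+1) F_(n-1) - F_n² with F_(n-1) eliminated. As (-1)^n and L_n become polynomials in
-- F_n and F_(n+1), the multiplication formulas below reduce to ring identities.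
cassini : ∀ n → let a = + fib n; b = + fib (suc n) in
  ℤ.-1ℤ ℤ.^ n ≡ b ℤ.* b ℤ.- a ℤ.* b ℤ.- a ℤ.* a
cassini zero    = refl
cassini (suc n) = trans (cong (ℤ.-1ℤ ℤ.*_) (cassini n)) (lemma (+ fib n) (+ fib (suc n)))
  where
  lemma : ∀ a b → ℤ.-1ℤ ℤ.* (b ℤ.* b ℤ.- a ℤ.* b ℤ.- a ℤ.* a)
    ≡ (b ℤ.+ a) ℤ.* (b ℤ.+ a) ℤ.- b ℤ.* (b ℤ.+ a) ℤ.- b ℤ.* b
  lemma = ℤ.solve-∀

luc≡2fib[1+n]-fib : ∀ n → + luc n ≡ + 2 ℤ.* + fib (suc n) ℤ.- + fib n
luc≡2fib[1+n]-fib zero          = refl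
luc≡2fib[1+n]-fib (suc zero)    = refl
luc≡2fib[1+n]-fib (suc (suc n)) =
  trans (cong₂ ℤ._+_ (luc≡2fib[1+n]-fib (suc n)) (luc≡2fib[1+n]-fib n))
    (lemma (+ fib n) (+ fib (suc n)))
  where
  lemma : ∀ a b → (+ 2 ℤ.* (b ℤ.+ a) ℤ.- b) ℤ.+ (+ 2 ℤ.* b ℤ.- a)
    ≡ + 2 ℤ.* ((b ℤ.+ a) ℤ.+ b) ℤ.- (b ℤ.+ a)
  lemma = ℤ.solve-∀

fib-2* : ∀ n → + fib (2 ℕ.* n) ≡ + fib n ℤ.* + luc n
fib-2* n = begin
  + fib (n ℕ.+ (n ℕ.+ 0))  ≡⟨ cong (λ m → + fib (n ℕ.+ m)) (ℕ.+-identityʳ n) ⟩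
  + fib (n ℕ.+ n)          ≡⟨ fib-+ n n ⟩
  a ℤ.* b ℤ.+ b ℤ.* a ℤ.- a ℤ.* a  ≡⟨ factor a b ⟩
  a ℤ.* (+ 2 ℤ.* b ℤ.- a)  ≡⟨ cong (a ℤ.*_) (luc≡2fib[1+n]-fib n) ⟨
  a ℤ.* + luc n            ∎
  where
  a = + fib n
  b = + fib (suc n)
  factor : ∀ a b → a ℤ.* b ℤ.+ b ℤ.* a ℤ.- a ℤ.* a ≡ a ℤ.* (+ 2 ℤ.* b ℤ.- a)
  factor = ℤ.solve-∀

fib-1+2* : ∀ n → let a = + fib n; b = + fib (suc n) in
  + fib (suc (2 ℕ.* n)) ≡ a ℤ.* a ℤ.+ b ℤ.* b
fib-1+2* n = begin
  + fib (suc n ℕ.+ (n ℕ.+ 0))  ≡⟨ cong (λ m → + fib (suc n ℕ.+ m)) (ℕ.+-identityʳ n) ⟩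
  + fib (suc n ℕ.+ n)          ≡⟨ fib-+ (suc n) n ⟩
  b ℤ.* b ℤ.+ (b ℤ.+ a) ℤ.* a ℤ.- b ℤ.* a  ≡⟨ collect a b ⟩
  a ℤ.* a ℤ.+ b ℤ.* b ∎
  where
  a = + fib n
  b = + fib (suc n)
  collect : ∀ a b → b ℤ.* b ℤ.+ (b ℤ.+ a) ℤ.* a ℤ.- b ℤ.* a ≡ a ℤ.* a ℤ.+ b ℤ.* b
  collect = ℤ.solve-∀

fib-3* : ∀ n → + fib (3 ℕ.* n) ≡ + fib n ℤ.* (+ luc n ℤ.* + luc n ℤ.- ℤ.-1ℤ ℤ.^ n)
fib-3* n = begin
  + fib (n ℕ.+ 2 ℕ.* n)
    ≡⟨ fib-+ n (2 ℕ.* n) ⟩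
  a ℤ.* + fib (suc (2 ℕ.* n)) ℤ.+ b ℤ.* + fib (2 ℕ.* n) ℤ.- a ℤ.* + fib (2 ℕ.* n)
    ≡⟨ cong₂ (λ x y → a ℤ.* x ℤ.+ b ℤ.* y ℤ.- a ℤ.* y) (fib-1+2* n)
         (trans (fib-2* n) (cong (a ℤ.*_) (luc≡2fib[1+n]-fib n))) ⟩
  a ℤ.* (a ℤ.* a ℤ.+ b ℤ.* b) ℤ.+ b ℤ.* (a ℤ.* l) ℤ.- a ℤ.* (a ℤ.* l)
    ≡⟨ factor a b ⟩
  a ℤ.* (l ℤ.* l ℤ.- (b ℤ.* b ℤ.- a ℤ.* b ℤ.- a ℤ.* a))
    ≡⟨ cong₂ (λ l e → a ℤ.* (l ℤ.* l ℤ.- e)) (luc≡2fib[1+n]-fib n) (cassini n) ⟨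
  a ℤ.* (+ luc n ℤ.* + luc n ℤ.- ℤ.-1ℤ ℤ.^ n) ∎
  where
  a = + fib n
  b = + fib (suc n)
  l = + 2 ℤ.* b ℤ.- a
  factor : ∀ a b → let l = + 2 ℤ.* b ℤ.- a in
    a ℤ.* (a ℤ.* a ℤ.+ b ℤ.* b) ℤ.+ b ℤ.* (a ℤ.* l) ℤ.- a ℤ.* (a ℤ.* l)
      ≡ a ℤ.* (l ℤ.* l ℤ.- (b ℤ.* b ℤ.- a ℤ.* b ℤ.- a ℤ.* a))
  factor = ℤ.solve-∀

luc-3* : ∀ n → + luc (3 ℕ.* n) ≡ + luc n ℤ.* (+ 5 ℤ.* (+ fib n ℤ.* + fib n) ℤ.+ ℤ.-1ℤ ℤ.^ n)
luc-3* n = begin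
  + luc (3 ℕ.* n)
    ≡⟨ luc≡2fib[1+n]-fib (3 ℕ.* n) ⟩
  + 2 ℤ.* + fib (suc n ℕ.+ 2 ℕ.* n) ℤ.- + fib (n ℕ.+ 2 ℕ.* n)
    ≡⟨ cong₂ (λ x y → + 2 ℤ.* x ℤ.- y) (fib-+ (suc n) (2 ℕ.* n)) (fib-+ n (2 ℕ.* n)) ⟩
  expression (+ fib (suc (2 ℕ.* n))) (+ fib (2 ℕ.* n))
    ≡⟨ cong₂ expression (fib-1+2* n)
         (trans (fib-2* n) (cong (a ℤ.*_) (luc≡2fib[1+n]-fib n))) ⟩
  expression (a ℤ.* a ℤ.+ b ℤ.* b) (a ℤ.* l)
    ≡⟨ factor a b ⟩
  l ℤ.* (+ 5 ℤ.* (a ℤ.* a) ℤ.+ (b ℤ.* b ℤ.- a ℤ.* b ℤ.- a ℤ.* a))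
    ≡⟨ cong₂ (λ l e → l ℤ.* (+ 5 ℤ.* (a ℤ.* a) ℤ.+ e)) (luc≡2fib[1+n]-fib n) (cassini n) ⟨
  + luc n ℤ.* (+ 5 ℤ.* (a ℤ.* a) ℤ.+ ℤ.-1ℤ ℤ.^ n) ∎
  where
  a = + fib n
  b = + fib (suc n)
  l = + 2 ℤ.* b ℤ.- a
  expression : ℤ → ℤ → ℤ
  expression x y = + 2 ℤ.* (b ℤ.* x ℤ.+ (b ℤ.+ a) ℤ.* y ℤ.- b ℤ.* y)
    ℤ.- (a ℤ.* x ℤ.+ b ℤ.* y ℤ.- a ℤ.* y)
  factor : ∀ a b → let l = + 2 ℤ.* b ℤ.- a; x = a ℤ.* a ℤ.+ b ℤ.* b; y = a ℤ.* l in
    + 2 ℤ.* (b ℤ.* x ℤ.+ (b ℤ.+ a) ℤ.* y ℤ.- b ℤ.* y) ℤ.- (a ℤ.* x ℤ.+ b ℤ.* y ℤ.- a ℤ.* y)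
      ≡ l ℤ.* (+ 5 ℤ.* (a ℤ.* a) ℤ.+ (b ℤ.* b ℤ.- a ℤ.* b ℤ.- a ℤ.* a))
  factor = ℤ.solve-∀

-- Twice or three times a negative integer computes to the form `Sign.- ◃ n`. With the sign -(-1)^n
-- in place of (-1)^(n-1), the formula also covers n = 0.
F-◃ : ∀ n → F (Sign.- ℤ.◃ n) ≡ ℤ.- (ℤ.-1ℤ ℤ.^ n ℤ.* + fib n)
F-◃ zero    = refl
F-◃ (suc m) = lemma (ℤ.-1ℤ ℤ.^ m) (+ fib (suc m))
  where
  lemma : ∀ e f → e ℤ.* f ≡ ℤ.- (ℤ.-1ℤ ℤ.* e ℤ.* f)
  lemma = ℤ.solve-∀

L-◃ : ∀ n → L (Sign.- ℤ.◃ n) ≡ ℤ.-1ℤ ℤ.^ n ℤ.* + luc n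
L-◃ zero    = refl
L-◃ (suc m) = refl

-1^n*-1^n≡1 : ∀ n → ℤ.-1ℤ ℤ.^ n ℤ.* ℤ.-1ℤ ℤ.^ n ≡ + 1
-1^n*-1^n≡1 zero    = refl
-1^n*-1^n≡1 (suc n) = trans (lemma (ℤ.-1ℤ ℤ.^ n)) (-1^n*-1^n≡1 n)
  where
  lemma : ∀ e → ℤ.-1ℤ ℤ.* e ℤ.* (ℤ.-1ℤ ℤ.* e) ≡ e ℤ.* e
  lemma = ℤ.solve-∀

-- Left as a square and not reduced to 1, so that at a negative index one factor can go to `F` and
-- the other to `L`.
-1^2n : ∀ n → ℤ.-1ℤ ℤ.^ (2 ℕ.* n) ≡ ℤ.-1ℤ ℤ.^ n ℤ.* ℤ.-1ℤ ℤ.^ n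
-1^2n n = trans (cong (λ m → ℤ.-1ℤ ℤ.^ (n ℕ.+ m)) (ℕ.+-identityʳ n))
  (ℤ.^-distribˡ-+-* ℤ.-1ℤ n n)

-1^3n : ∀ n → ℤ.-1ℤ ℤ.^ (3 ℕ.* n) ≡ ℤ.-1ℤ ℤ.^ n
-1^3n n = begin
  ℤ.-1ℤ ℤ.^ (n ℕ.+ 2 ℕ.* n)          ≡⟨ ℤ.^-distribˡ-+-* ℤ.-1ℤ n (2 ℕ.* n) ⟩
  e ℤ.* ℤ.-1ℤ ℤ.^ (2 ℕ.* n)          ≡⟨ cong (e ℤ.*_) (trans (-1^2n n) (-1^n*-1^n≡1 n)) ⟩
  e ℤ.* + 1                          ≡⟨ ℤ.*-identityʳ e ⟩
  e                                  ∎
  where e = ℤ.-1ℤ ℤ.^ n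

F-2* : ∀ p → F (+ 2 ℤ.* p) ≡ F p ℤ.* L p
F-2* (+ n)      = trans (cong F (ℤ.+◃n≡+n (2 ℕ.* n))) (fib-2* n)
F-2* p@(-[1+ m ]) = begin
  F (Sign.- ℤ.◃ 2 ℕ.* n)
    ≡⟨ F-◃ (2 ℕ.* n) ⟩
  ℤ.- (ℤ.-1ℤ ℤ.^ (2 ℕ.* n) ℤ.* + fib (2 ℕ.* n))
    ≡⟨ cong₂ (λ e f → ℤ.- (e ℤ.* f)) (-1^2n n) (fib-2* n) ⟩
  ℤ.- (e ℤ.* e ℤ.* (+ fib n ℤ.* + luc n))
    ≡⟨ regroup e (+ fib n) (+ luc n) ⟩
  ℤ.- (e ℤ.* + fib n) ℤ.* (e ℤ.* + luc n)
    ≡⟨ cong (ℤ._* (e ℤ.* + luc n)) (F-◃ n) ⟨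
  F p ℤ.* L p ∎
  where
  n = suc m
  e = ℤ.-1ℤ ℤ.^ n
  regroup : ∀ e f l → ℤ.- (e ℤ.* e ℤ.* (f ℤ.* l)) ≡ ℤ.- (e ℤ.* f) ℤ.* (e ℤ.* l)
  regroup = ℤ.solve-∀

F-3* : ∀ p → F (+ 3 ℤ.* p) ≡ F p ℤ.* (L p ℤ.* L p ℤ.- ℤ.-1ℤ ℤ.^ ℤ.∣ p ∣)
F-3* (+ n)      = trans (cong F (ℤ.+◃n≡+n (3 ℕ.* n))) (fib-3* n)
F-3* p@(-[1+ m ]) = begin
  F (Sign.- ℤ.◃ 3 ℕ.* n)
    ≡⟨ F-◃ (3 ℕ.* n) ⟩
  ℤ.- (ℤ.-1ℤ ℤ.^ (3 ℕ.* n) ℤ.* + fib (3 ℕ.* n))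
    ≡⟨ cong₂ (λ e f → ℤ.- (e ℤ.* f)) (-1^3n n) (fib-3* n) ⟩
  ℤ.- (e ℤ.* (f ℤ.* (l ℤ.* l ℤ.- e)))
    -- The coefficient 1 makes room for e * e, which turns l² into (el)² = (L p)².
    ≡⟨ unit e f l ⟩
  ℤ.- (e ℤ.* f) ℤ.* (+ 1 ℤ.* (l ℤ.* l) ℤ.- e)
    ≡⟨ cong (λ z → ℤ.- (e ℤ.* f) ℤ.* (z ℤ.* (l ℤ.* l) ℤ.- e)) (-1^n*-1^n≡1 n) ⟨
  ℤ.- (e ℤ.* f) ℤ.* (e ℤ.* e ℤ.* (l ℤ.* l) ℤ.- e)
    ≡⟨ cong₂ (λ a b → a ℤ.* (b ℤ.- e)) (sym (F-◃ n)) (square e l) ⟩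
  F p ℤ.* (L p ℤ.* L p ℤ.- e) ∎
  where
  n = suc m
  e = ℤ.-1ℤ ℤ.^ n
  f = + fib n
  l = + luc n
  unit : ∀ e f l →
    ℤ.- (e ℤ.* (f ℤ.* (l ℤ.* l ℤ.- e))) ≡ ℤ.- (e ℤ.* f) ℤ.* (+ 1 ℤ.* (l ℤ.* l) ℤ.- e)
  unit = ℤ.solve-∀
  square : ∀ e l → e ℤ.* e ℤ.* (l ℤ.* l) ≡ e ℤ.* l ℤ.* (e ℤ.* l)
  square = ℤ.solve-∀

L-3* : ∀ p → L (+ 3 ℤ.* p) ≡ L p ℤ.* (+ 5 ℤ.* (F p ℤ.* F p) ℤ.+ ℤ.-1ℤ ℤ.^ ℤ.∣ p ∣)
L-3* (+ n)      = trans (cong L (ℤ.+◃n≡+n (3 ℕ.* n))) (luc-3* n)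
L-3* p@(-[1+ m ]) = begin
  L (Sign.- ℤ.◃ 3 ℕ.* n)
    ≡⟨ L-◃ (3 ℕ.* n) ⟩
  ℤ.-1ℤ ℤ.^ (3 ℕ.* n) ℤ.* + luc (3 ℕ.* n)
    ≡⟨ cong₂ ℤ._*_ (-1^3n n) (luc-3* n) ⟩
  e ℤ.* (l ℤ.* (+ 5 ℤ.* (f ℤ.* f) ℤ.+ e))
    -- Here e * e turns f² into (-ef)² = (F p)².
    ≡⟨ unit e f l ⟩
  e ℤ.* l ℤ.* (+ 5 ℤ.* (+ 1 ℤ.* (f ℤ.* f)) ℤ.+ e)
    ≡⟨ cong (λ z → e ℤ.* l ℤ.* (+ 5 ℤ.* (z ℤ.* (f ℤ.* f)) ℤ.+ e)) (-1^n*-1^n≡1 n) ⟨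
  e ℤ.* l ℤ.* (+ 5 ℤ.* (e ℤ.* e ℤ.* (f ℤ.* f)) ℤ.+ e)
    ≡⟨ cong (λ z → e ℤ.* l ℤ.* (+ 5 ℤ.* z ℤ.+ e))
         (trans (square e f) (sym (cong₂ ℤ._*_ (F-◃ n) (F-◃ n)))) ⟩
  L p ℤ.* (+ 5 ℤ.* (F p ℤ.* F p) ℤ.+ e) ∎
  where
  n = suc m
  e = ℤ.-1ℤ ℤ.^ n
  f = + fib n
  l = + luc n
  unit : ∀ e f l → e ℤ.* (l ℤ.* (+ 5 ℤ.* (f ℤ.* f) ℤ.+ e))
    ≡ e ℤ.* l ℤ.* (+ 5 ℤ.* (+ 1 ℤ.* (f ℤ.* f)) ℤ.+ e)
  unit = ℤ.solve-∀
  square : ∀ e f → e ℤ.* e ℤ.* (f ℤ.* f) ≡ ℤ.- (e ℤ.* f) ℤ.* ℤ.- (e ℤ.* f)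
  square = ℤ.solve-∀

-- The signs and the two quotients as rationals.

ε : ℤ → ℚ
ε p = fromℤ (ℤ.-1ℤ ℤ.^ ℤ.∣ p ∣)

ε*ε≡1 : ∀ p → ε p * ε p ≡ 1ℚ
ε*ε≡1 p = trans (sym (fromℤ-homo-* e e)) (cong fromℤ (-1^n*-1^n≡1 ℤ.∣ p ∣))
  where e = ℤ.-1ℤ ℤ.^ ℤ.∣ p ∣

-1^ᶻ≡ε : ∀ p → -1ℚ ^ᶻ p ≡ ε p
-1^ᶻ≡ε (+ n)    = sym (fromℤ-homo-^ ℤ.-1ℤ n)
-- `1/ -1ℚ` computes to -1, so a negative exponent p gives the same power as |p|.
-1^ᶻ≡ε -[1+ m ] = sym (fromℤ-homo-^ ℤ.-1ℤ (suc m))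

-1^ᶻ[p*n]≡ε^n : ∀ p n → -1ℚ ^ᶻ (p ℤ.* + n) ≡ ε p ^ n
-1^ᶻ[p*n]≡ε^n p n = begin
  -1ℚ ^ᶻ (p ℤ.* + n)                    ≡⟨ -1^ᶻ≡ε (p ℤ.* + n) ⟩
  fromℤ (ℤ.-1ℤ ℤ.^ ℤ.∣ p ℤ.* + n ∣)     ≡⟨ cong (λ m → fromℤ (ℤ.-1ℤ ℤ.^ m)) (ℤ.abs-* p (+ n)) ⟩
  fromℤ (ℤ.-1ℤ ℤ.^ (ℤ.∣ p ∣ ℕ.* n))     ≡⟨ cong fromℤ (ℤ.^-*-assoc ℤ.-1ℤ ℤ.∣ p ∣ n) ⟨
  fromℤ ((ℤ.-1ℤ ℤ.^ ℤ.∣ p ∣) ℤ.^ n)     ≡⟨ fromℤ-homo-^ (ℤ.-1ℤ ℤ.^ ℤ.∣ p ∣) n ⟩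
  ε p ^ n                               ∎

-- Adding 1 raises |p| by one for p ≥ 0 and lowers it by one for p < 0; the parity changes either
-- way.
ε[p+1]≡-ε : ∀ p → ε (p ℤ.+ + 1) ≡ - ε p
ε[p+1]≡-ε p = trans (cong fromℤ (parity p)) (fromℤ-homo-neg (ℤ.-1ℤ ℤ.^ ℤ.∣ p ∣))
  where
  neg-neg : ∀ e → e ≡ ℤ.- (ℤ.-1ℤ ℤ.* e)
  neg-neg = ℤ.solve-∀
  parity : ∀ p → ℤ.-1ℤ ℤ.^ ℤ.∣ p ℤ.+ + 1 ∣ ≡ ℤ.- (ℤ.-1ℤ ℤ.^ ℤ.∣ p ∣)
  parity (+ n) = trans (cong (ℤ.-1ℤ ℤ.^_) (ℕ.+-comm n 1)) (ℤ.-1*i≡-i _)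
  parity -[1+ zero ]  = refl
  parity -[1+ suc m ] = neg-neg (ℤ.-1ℤ ℤ.^ suc m)

-- F_(3p) and F_(2p) share the factor F_p. The right side has the shape cu + sv required by
-- `coeff-powerSum-scaled`, with c = 1 and s = -e.
F[3p]÷F[2p] : ∀ p .{{_ : ℤ.NonZero p}} → let instance _ = F[2p]-nonZero p; _ = L-nonZero p in
  F (+ 3 ℤ.* p) ÷ᶻ F (+ 2 ℤ.* p) ≡ 1ℚ * fromℤ (L p) + - ε p * 1/ fromℤ (L p)
F[3p]÷F[2p] p = ÷ᶻ-unique (F (+ 3 ℤ.* p)) (F (+ 2 ℤ.* p)) _ (begin
  fromℤ (F (+ 3 ℤ.* p))
    ≡⟨ cong fromℤ (F-3* p) ⟩
  fromℤ (F p ℤ.* (L p ℤ.* L p ℤ.- e))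
    ≡⟨ trans (fromℤ-homo-* (F p) _) (cong (f *_) (trans (fromℤ-homo-+ (L p ℤ.* L p) (ℤ.- e))
         (cong₂ _+_ (fromℤ-homo-* (L p) (L p)) (fromℤ-homo-neg e)))) ⟩
  f * (l * l - ε p)
    -- Multiplying e by 1 = l * (1/l) makes the remaining step a polynomial identity with 1/l as an
    -- independent variable.
    ≡⟨ cong (λ z → f * (l * l - z)) (ℚ.*-identityʳ (ε p)) ⟨
  f * (l * l - ε p * 1ℚ)
    ≡⟨ cong (λ z → f * (l * l - ε p * z)) (ℚ.*-inverseʳ l) ⟨
  f * (l * l - ε p * (l * 1/ l))
    ≡⟨ factor f l (ε p) (1/ l) ⟩
  (1ℚ * l + - ε p * 1/ l) * (f * l)
    ≡⟨ cong ((1ℚ * l + - ε p * 1/ l) *_)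
         (trans (cong fromℤ (F-2* p)) (fromℤ-homo-* (F p) (L p))) ⟨
  (1ℚ * l + - ε p * 1/ l) * fromℤ (F (+ 2 ℤ.* p)) ∎)
  where
  instance
    _ = F[2p]-nonZero p
    _ = L-nonZero p
  e = ℤ.-1ℤ ℤ.^ ℤ.∣ p ∣
  f = fromℤ (F p)
  l = fromℤ (L p)
  factor : ∀ f l e i → f * (l * l - e * (l * i)) ≡ (1ℚ * l + - e * i) * (f * l)
  factor = solve-∀ ℚ-ring

-- Here the shared factor is L_p, and the shape cu + sv has c = 5 and s = e.
L[3p]÷F[2p] : ∀ p .{{_ : ℤ.NonZero p}} → let instance _ = F[2p]-nonZero p; _ = F-nonZero p in
  L (+ 3 ℤ.* p) ÷ᶻ F (+ 2 ℤ.* p) ≡ fromℤ (+ 5) * fromℤ (F p) + ε p * 1/ fromℤ (F p)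
L[3p]÷F[2p] p = ÷ᶻ-unique (L (+ 3 ℤ.* p)) (F (+ 2 ℤ.* p)) _ (begin
  fromℤ (L (+ 3 ℤ.* p))
    ≡⟨ cong fromℤ (L-3* p) ⟩
  fromℤ (L p ℤ.* (+ 5 ℤ.* (F p ℤ.* F p) ℤ.+ e))
    ≡⟨ trans (fromℤ-homo-* (L p) _) (cong (l *_) (trans (fromℤ-homo-+ (+ 5 ℤ.* (F p ℤ.* F p)) e)
         (cong (_+ ε p) (trans (fromℤ-homo-* (+ 5) (F p ℤ.* F p)) (cong (c *_) (fromℤ-homo-* (F p) (F p))))))) ⟩
  l * (c * (f * f) + ε p)
    ≡⟨ cong (λ z → l * (c * (f * f) + z)) (ℚ.*-identityʳ (ε p)) ⟨
  l * (c * (f * f) + ε p * 1ℚ)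
    ≡⟨ cong (λ z → l * (c * (f * f) + ε p * z)) (ℚ.*-inverseʳ f) ⟨
  l * (c * (f * f) + ε p * (f * 1/ f))
    ≡⟨ factor c f l (ε p) (1/ f) ⟩
  (c * f + ε p * 1/ f) * (f * l)
    ≡⟨ cong ((c * f + ε p * 1/ f) *_)
         (trans (cong fromℤ (F-2* p)) (fromℤ-homo-* (F p) (L p))) ⟨
  (c * f + ε p * 1/ f) * fromℤ (F (+ 2 ℤ.* p)) ∎)
  where
  instance
    _ = F[2p]-nonZero p
    _ = F-nonZero p
  e = ℤ.-1ℤ ℤ.^ ℤ.∣ p ∣
  c = fromℤ (+ 5)
  f = fromℤ (F p)
  l = fromℤ (L p)
  factor : ∀ c f l e i → l * (c * (f * f) + e * (f * i)) ≡ (c * f + e * i) * (f * l)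
  factor = solve-∀ ℚ-ring

theorem13 : ∀ (n : ℕ) (p : ℤ) .{{_ : ℤ.NonZero p}} →
  let instance
        _ = F[2p]-nonZero p
        _ = 2L^-nonZero p (2 ℕ.* n)
        _ = 2F^-nonZero p (2 ℕ.* n)
  in
  (∑[ k ≤ n ] (-1ℚ ^ᶻ (p ℤ.* + (n ∸ k)) * coeff n k
               * (F (+ 3 ℤ.* p) ÷ᶻ F (+ 2 ℤ.* p)) ^ (2 ℕ.* k))
    ≡ (L p ℤ.^ (4 ℕ.* n) ℤ.+ + 1) ÷ᶻ (+ 2 ℤ.* L p ℤ.^ (2 ℕ.* n)))
  × (∑[ k ≤ n ] (-1ℚ ^ᶻ ((p ℤ.+ + 1) ℤ.* + (n ∸ k)) * coeff n k
                 * fromℤ (+ 5) ^ (n ∸ k)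
                 * (L (+ 3 ℤ.* p) ÷ᶻ F (+ 2 ℤ.* p)) ^ (2 ℕ.* k))
    ≡ ((+ 5) ℤ.^ (2 ℕ.* n) ℤ.* F p ℤ.^ (4 ℕ.* n) ℤ.+ + 1) ÷ᶻ (+ 2 ℤ.* F p ℤ.^ (2 ℕ.* n)))
theorem13 n p = trans sum₁ (sym value₁) , trans sum₂ (sym value₂)
  where
  instance
    _ = F[2p]-nonZero p
    _ = L-nonZero p
    _ = F-nonZero p
    _ = 2L^-nonZero p (2 ℕ.* n)
    _ = 2F^-nonZero p (2 ℕ.* n)

  u₁ = fromℤ (L p)
  v₁ = 1/ u₁
  -- This equals `ε p`; it is kept in the form -(cs) that `coeff-powerSum-scaled` expects.
  q₁ = - (1ℚ * - ε p)
  x₁ = 1ℚ * u₁ + - ε p * v₁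
  S₁ = homogeneous q₁ (x₁ ^ 2) n (coeff n)

  sum₁ : (∑[ k ≤ n ] (-1ℚ ^ᶻ (p ℤ.* + (n ∸ k)) * coeff n k
           * (F (+ 3 ℤ.* p) ÷ᶻ F (+ 2 ℤ.* p)) ^ (2 ℕ.* k))) ≡ S₁
  sum₁ = ∑-cong n λ k _ → cong₂ (λ a b → a * coeff n k * b)
    (trans (-1^ᶻ[p*n]≡ε^n p (n ∸ k)) (^-congˡ (n ∸ k) (negate (ε p))))
    (trans (^-congˡ (2 ℕ.* k) (F[3p]÷F[2p] p)) (sym (^-assocʳ x₁ 2 k)))
    where
    negate : ∀ e → e ≡ - (1ℚ * - e)
    negate = solve-∀ ℚ-ring

  value₁ : (L p ℤ.^ (4 ℕ.* n) ℤ.+ + 1) ÷ᶻ (+ 2 ℤ.* L p ℤ.^ (2 ℕ.* n)) ≡ S₁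
  value₁ = ÷ᶻ-unique (L p ℤ.^ (4 ℕ.* n) ℤ.+ + 1) (+ 2 ℤ.* L p ℤ.^ (2 ℕ.* n)) S₁ (begin
    fromℤ (L p ℤ.^ (4 ℕ.* n) ℤ.+ + 1)
      ≡⟨ trans (fromℤ-homo-+ (L p ℤ.^ (4 ℕ.* n)) (+ 1))
           (cong (_+ 1ℚ) (fromℤ-homo-^ (L p) (4 ℕ.* n))) ⟩
    u₁ ^ (4 ℕ.* n) + 1ℚ
      -- The inserted factor 1^(2n) is c^(2n) for c = 1.
      ≡⟨ cong (_+ 1ℚ) (trans (cong (_* u₁ ^ (4 ℕ.* n)) (1^n≡1 (2 ℕ.* n)))
           (ℚ.*-identityˡ (u₁ ^ (4 ℕ.* n)))) ⟨
    1ℚ ^ (2 ℕ.* n) * u₁ ^ (4 ℕ.* n) + 1ℚ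
      ≡⟨ coeff-powerSum-scaled 1ℚ (- ε p) u₁ v₁
           (trans (neg-square (ε p)) (ε*ε≡1 p)) (ℚ.*-inverseʳ u₁) n ⟨
    S₁ * (fromℤ (+ 2) * u₁ ^ (2 ℕ.* n))
      ≡⟨ cong (S₁ *_) (trans (fromℤ-homo-* (+ 2) _)
           (cong (fromℤ (+ 2) *_) (fromℤ-homo-^ (L p) (2 ℕ.* n)))) ⟨
    S₁ * fromℤ (+ 2 ℤ.* L p ℤ.^ (2 ℕ.* n)) ∎)
    where
    neg-square : ∀ e → - e * - e ≡ e * e
    neg-square = solve-∀ ℚ-ring

  c₂ = fromℤ (+ 5)
  u₂ = fromℤ (F p)
  v₂ = 1/ u₂
  q₂ = - (c₂ * ε p)
  x₂ = c₂ * u₂ + ε p * v₂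
  S₂ = homogeneous q₂ (x₂ ^ 2) n (coeff n)

  sum₂ : (∑[ k ≤ n ] (-1ℚ ^ᶻ ((p ℤ.+ + 1) ℤ.* + (n ∸ k)) * coeff n k
           * fromℤ (+ 5) ^ (n ∸ k)
           * (L (+ 3 ℤ.* p) ÷ᶻ F (+ 2 ℤ.* p)) ^ (2 ℕ.* k))) ≡ S₂
  sum₂ = ∑-cong n λ k _ → cong₂ _*_ (signs k)
    (trans (^-congˡ (2 ℕ.* k) (L[3p]÷F[2p] p)) (sym (^-assocʳ x₂ 2 k)))
    where
    swap : ∀ x c y → x * c * y ≡ (x * y) * c
    swap = solve-∀ ℚ-ring
    negate : ∀ c e → - e * c ≡ - (c * e)
    negate = solve-∀ ℚ-ring
    -- Since (-1)^(p+1) = -e, the sign and the power of 5 merge into (-5e)^(n-k), a power of `q₂`.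
    signs : ∀ k → -1ℚ ^ᶻ ((p ℤ.+ + 1) ℤ.* + (n ∸ k)) * coeff n k * c₂ ^ (n ∸ k)
      ≡ q₂ ^ (n ∸ k) * coeff n k
    signs k = begin
      -1ℚ ^ᶻ ((p ℤ.+ + 1) ℤ.* + m) * coeff n k * c₂ ^ m
        ≡⟨ cong (λ z → z * coeff n k * c₂ ^ m)
             (trans (-1^ᶻ[p*n]≡ε^n (p ℤ.+ + 1) m) (^-congˡ m (ε[p+1]≡-ε p))) ⟩
      (- ε p) ^ m * coeff n k * c₂ ^ m
        ≡⟨ swap ((- ε p) ^ m) (coeff n k) (c₂ ^ m) ⟩
      (- ε p) ^ m * c₂ ^ m * coeff n k
        ≡⟨ cong (_* coeff n k) (trans (sym (^-distrib-* (- ε p) c₂ m))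
             (^-congˡ m (negate c₂ (ε p)))) ⟩
      q₂ ^ m * coeff n k ∎
      where m = n ∸ k

  value₂ : ((+ 5) ℤ.^ (2 ℕ.* n) ℤ.* F p ℤ.^ (4 ℕ.* n) ℤ.+ + 1) ÷ᶻ (+ 2 ℤ.* F p ℤ.^ (2 ℕ.* n)) ≡ S₂
  value₂ = ÷ᶻ-unique ((+ 5) ℤ.^ (2 ℕ.* n) ℤ.* F p ℤ.^ (4 ℕ.* n) ℤ.+ + 1)
    (+ 2 ℤ.* F p ℤ.^ (2 ℕ.* n)) S₂ (begin
    fromℤ ((+ 5) ℤ.^ (2 ℕ.* n) ℤ.* F p ℤ.^ (4 ℕ.* n) ℤ.+ + 1)
      ≡⟨ trans (fromℤ-homo-+ ((+ 5) ℤ.^ (2 ℕ.* n) ℤ.* F p ℤ.^ (4 ℕ.* n)) (+ 1)) (cong (_+ 1ℚ) (trans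
           (fromℤ-homo-* ((+ 5) ℤ.^ (2 ℕ.* n)) (F p ℤ.^ (4 ℕ.* n)))
           (cong₂ _*_ (fromℤ-homo-^ (+ 5) (2 ℕ.* n)) (fromℤ-homo-^ (F p) (4 ℕ.* n))))) ⟩
    c₂ ^ (2 ℕ.* n) * u₂ ^ (4 ℕ.* n) + 1ℚ
      ≡⟨ coeff-powerSum-scaled c₂ (ε p) u₂ v₂ (ε*ε≡1 p) (ℚ.*-inverseʳ u₂) n ⟨
    S₂ * (fromℤ (+ 2) * u₂ ^ (2 ℕ.* n))
      ≡⟨ cong (S₂ *_) (trans (fromℤ-homo-* (+ 2) _)
           (cong (fromℤ (+ 2) *_) (fromℤ-homo-^ (F p) (2 ℕ.* n)))) ⟨
    S₂ * fromℤ (+ 2 ℤ.* F p ℤ.^ (2 ℕ.* n)) ∎)
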